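{- Let $p$ be an odd prime and let $r$ be an integer with $0 \leq r \leq \frac{p-1}{2}$. Then \[ \sum_{j=r}^{\frac{p-1}{2}} \binom{2j}{j}\binom{j}{r} 2^{p-1-2j} \equiv \begin{cases} 0 \pmod{p}, & \text{if } r < \frac{p-1}{2},\\ (-1)^{\frac{p-1}{2}} \pmod{p}, & \text{if } r = \frac{p-1}{2}. \end{cases} \] -}

module Defs where

open import Data.Integer.Base using (ℤ; +_; _-_)
open import Data.Integer.Divisibility using (_∣_)
open import Data.List.Base using (map; upTo)
open import Data.Nat.Base using (ℕ; suc; _+_; _∸_)
open import Data.Nat.ListAction using (sum)

-- The sum of f a, f (a + 1), …, f b, with both endpoints included.
-- It is empty, hence 0, when b < a.
sumFromTo : ℕ → ℕ → (ℕ → ℕ) → ℕ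
sumFromTo a b f = sum (map (λ i → f (a + i)) (upTo (suc b ∸ a)))

infix 6 sumFromTo
syntax sumFromTo a b (λ j → e) = ∑[ j from a to b ] e

infix 4 _≡_[mod_]
_≡_[mod_] : ℤ → ℤ → ℕ → Set
x ≡ y [mod n ] = + n ∣ (x - y)

{-# OPTIONS --safe #-}
-- With j in place of the upper limit, the sum has the closed form
--   (2r + 1) ∑_{i=r}^{j} C(2i,i) C(i,r) 2^(N−2i) = (2j + 1) C(2j,j) C(j,r) 2^(N−2j),
-- which for N = p − 1 and j = (p − 1)/2 has right-hand side p · C(p−1,j) C(j,r).
-- If r < j then 0 < 2r + 1 < p, so p divides the sum.  If r = j the sum is the
-- single term C(p−1,j), which is (−1)^j modulo p.
module Submission where

open import Defs
open import Data.Integer.Base using (+_; -1ℤ; 0ℤ) renaming (_^_ to _^ℤ_)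
import Data.Integer.Base as ℤ
import Data.Integer.Divisibility.Signed as ℤ∣
import Data.Integer.Properties as ℤ
import Data.Integer.Tactic.RingSolver as ℤSolver
open import Data.List.Base using ([]; _∷_; _++_; map; upTo)
open import Data.List.Properties using (map-++; upTo-∷ʳ)
open import Data.Nat.Base using (ℕ; zero; suc; _+_; _*_; _∸_; _^_; _≤_; _<_; s≤s; s<s; z<s)
open import Data.Nat.Combinatorics
  using (_C_; nCk≡nC[n∸k]; nCk+nC[k+1]≡[n+1]C[k+1]; nCn≡1; nC1≡n; k>n⇒nCk≡0)
open import Data.Nat.Divisibility using (_∤_; divides; ∣⇒≤; m∣m*n) renaming (_∣_ to _∣ℕ_)
open import Data.Nat.DivMod using (_/_; _%_; m≡m%n+[m/n]*n; m%n<n)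
open import Data.Nat.ListAction using (sum)
open import Data.Nat.ListAction.Properties using (sum-++)
open import Data.Nat.Primality using (Prime; euclidsLemma)
open import Data.Nat.Properties
open import Data.Nat.Tactic.RingSolver using (solve-∀)
open import Data.Product.Base using (_×_; _,_)
open import Data.Sum.Base using (inj₁; inj₂)
open import Relation.Nullary.Negation using (contradiction)
open import Relation.Binary.PropositionalEquality
  using (_≡_; refl; sym; trans; cong; cong₂; subst; module ≡-Reasoning)

open ≡-Reasoning

-- Absorption identities and the recurrence of the central binomials.

[k+1]*[n+1]C[k+1]≡[n+1]*nCk : ∀ n k → suc k * (suc n C suc k) ≡ suc n * (n C k)
[k+1]*[n+1]C[k+1]≡[n+1]*nCk zero zero = refl
[k+1]*[n+1]C[k+1]≡[n+1]*nCk zero (suc k) = begin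
  suc (suc k) * (1 C suc (suc k)) ≡⟨ cong (suc (suc k) *_) (k>n⇒nCk≡0 (s<s (z<s {k}))) ⟩
  suc (suc k) * 0                 ≡⟨ *-zeroʳ (suc (suc k)) ⟩
  0                               ≡⟨ cong (1 *_) (k>n⇒nCk≡0 (z<s {k})) ⟨
  1 * (0 C suc k)                 ∎
[k+1]*[n+1]C[k+1]≡[n+1]*nCk (suc n) zero = begin
  1 * (suc (suc n) C 1)         ≡⟨ cong (1 *_) (nC1≡n (suc (suc n))) ⟩
  1 * suc (suc n)               ≡⟨ *-comm 1 (suc (suc n)) ⟩
  suc (suc n) * (suc n C 0)     ∎
[k+1]*[n+1]C[k+1]≡[n+1]*nCk (suc n) (suc k) = begin
  suc (suc k) * (suc (suc n) C suc (suc k))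
    ≡⟨ cong (suc (suc k) *_) (nCk+nC[k+1]≡[n+1]C[k+1] (suc n) (suc k)) ⟨
  suc (suc k) * (x + y)
    -- Setting one copy of `x` aside leaves exactly the multiples of `x` and `y` in the induction
    -- hypotheses at `k` and `suc k`; Pascal's rule then turns their sum into `suc n * x`.
    ≡⟨ expand (suc k) x y ⟩
  x + (suc k * x + suc (suc k) * y)
    ≡⟨ cong (λ z → x + z) (cong₂ _+_ ([k+1]*[n+1]C[k+1]≡[n+1]*nCk n k)
                              ([k+1]*[n+1]C[k+1]≡[n+1]*nCk n (suc k))) ⟩
  x + (suc n * (n C k) + suc n * (n C suc k))
    ≡⟨ cong (λ z → x + z) (*-distribˡ-+ (suc n) (n C k) (n C suc k)) ⟨
  x + suc n * (n C k + n C suc k)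
    ≡⟨ cong (λ z → x + suc n * z) (nCk+nC[k+1]≡[n+1]C[k+1] n k) ⟩
  suc (suc n) * x ∎
  where
  x = suc n C suc k
  y = suc n C suc (suc k)

  expand : ∀ k x y → suc k * (x + y) ≡ x + (k * x + suc k * y)
  expand = solve-∀

[m+n]Cm≡[m+n]Cn : ∀ m n → (m + n) C m ≡ (m + n) C n
[m+n]Cm≡[m+n]Cn m n = trans (nCk≡nC[n∸k] (m≤m+n m n)) (cong ((m + n) C_) (m+n∸m≡n m n))

-- Symmetry moves the lower index to `suc d`, where absorption applies. Writing the upper index as
-- `r + d` avoids truncated subtraction.
[d+1]*[r+d+1]Cr≡[r+d+1]*[r+d]Cr : ∀ r d →
  suc d * (suc (r + d) C r) ≡ suc (r + d) * ((r + d) C r)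
[d+1]*[r+d+1]Cr≡[r+d+1]*[r+d]Cr r d = begin
  suc d * (suc (r + d) C r)
    ≡⟨ cong (λ n → suc d * (n C r)) (+-suc r d) ⟨
  suc d * ((r + suc d) C r)
    ≡⟨ cong (suc d *_) ([m+n]Cm≡[m+n]Cn r (suc d)) ⟩
  suc d * ((r + suc d) C suc d)
    ≡⟨ cong (λ n → suc d * (n C suc d)) (+-suc r d) ⟩
  suc d * (suc (r + d) C suc d)
    ≡⟨ [k+1]*[n+1]C[k+1]≡[n+1]*nCk (r + d) d ⟩
  suc (r + d) * ((r + d) C d)
    ≡⟨ cong (suc (r + d) *_) ([m+n]Cm≡[m+n]Cn r d) ⟨
  suc (r + d) * ((r + d) C r) ∎

-- Pascal's rule splits the next central binomial into two entries that are equal by symmetry, and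
-- absorption evaluates one of them.
centralBinomial-suc : ∀ m →
  suc m * ((2 * suc m) C suc m) ≡ 2 * (suc (2 * m) * ((2 * m) C m))
centralBinomial-suc m = begin
  suc m * ((2 * suc m) C suc m)
    ≡⟨ cong (λ n → suc m * (n C suc m)) (*-suc 2 m) ⟩
  suc m * (suc (suc (2 * m)) C suc m)
    ≡⟨ cong (suc m *_) (nCk+nC[k+1]≡[n+1]C[k+1] (suc (2 * m)) m) ⟨
  suc m * (suc (2 * m) C m + suc (2 * m) C suc m)
    ≡⟨ cong (λ z → suc m * (z + suc (2 * m) C suc m)) symmetric ⟩
  suc m * (suc (2 * m) C suc m + suc (2 * m) C suc m)
    ≡⟨ double (suc m) (suc (2 * m) C suc m) ⟩
  2 * (suc m * (suc (2 * m) C suc m))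
    ≡⟨ cong (2 *_) ([k+1]*[n+1]C[k+1]≡[n+1]*nCk (2 * m) m) ⟩
  2 * (suc (2 * m) * ((2 * m) C m)) ∎
  where
  double : ∀ a b → a * (b + b) ≡ 2 * (a * b)
  double = solve-∀

  m+[m+1]≡2m+1 : ∀ m → m + suc m ≡ suc (2 * m)
  m+[m+1]≡2m+1 = solve-∀

  symmetric : suc (2 * m) C m ≡ suc (2 * m) C suc m
  symmetric = subst (λ n → n C m ≡ n C suc m) (m+[m+1]≡2m+1 m) ([m+n]Cm≡[m+n]Cn m (suc m))

-- Splitting off the last term of a sum.

sumFromTo-+ : ∀ a d f → sumFromTo a (a + d) f ≡ sum (map (λ i → f (a + i)) (upTo (suc d)))
sumFromTo-+ a d f = cong (λ n → sum (map (λ i → f (a + i)) (upTo n)))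
  (trans (cong (_∸ a) (sym (+-suc a d))) (m+n∸m≡n a (suc d)))

sumFromTo-singleton : ∀ a f → sumFromTo a a f ≡ f a
sumFromTo-singleton a f = begin
  sumFromTo a a f       ≡⟨ cong (λ b → sumFromTo a b f) (+-identityʳ a) ⟨
  sumFromTo a (a + 0) f ≡⟨ sumFromTo-+ a 0 f ⟩
  f (a + 0) + 0         ≡⟨ +-identityʳ (f (a + 0)) ⟩
  f (a + 0)             ≡⟨ cong f (+-identityʳ a) ⟩
  f a                   ∎

sumFromTo-suc : ∀ a d f →
  sumFromTo a (suc (a + d)) f ≡ sumFromTo a (a + d) f + f (suc (a + d))
sumFromTo-suc a d f = begin
  sumFromTo a (suc (a + d)) f
    ≡⟨ cong (λ b → sumFromTo a b f) (+-suc a d) ⟨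
  sumFromTo a (a + suc d) f
    ≡⟨ sumFromTo-+ a (suc d) f ⟩
  sum (map g (upTo (suc (suc d))))
    ≡⟨ cong (λ l → sum (map g l)) (upTo-∷ʳ (suc d)) ⟨
  sum (map g (upTo (suc d) ++ suc d ∷ []))
    ≡⟨ cong sum (map-++ g (upTo (suc d)) (suc d ∷ [])) ⟩
  sum (map g (upTo (suc d)) ++ g (suc d) ∷ [])
    ≡⟨ sum-++ (map g (upTo (suc d))) (g (suc d) ∷ []) ⟩
  sum (map g (upTo (suc d))) + (g (suc d) + 0)
    ≡⟨ cong₂ _+_ (sym (sumFromTo-+ a d f))
                 (trans (+-identityʳ (g (suc d))) (cong f (+-suc a d))) ⟩
  sumFromTo a (a + d) f + f (suc (a + d)) ∎
  where
  g : ℕ → ℕ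
  g i = f (a + i)

-- Ratio of consecutive terms and the closed form.

summand : ℕ → ℕ → ℕ → ℕ
summand N r j = ((2 * j) C j) * (j C r) * 2 ^ (N ∸ 2 * j)

-- The bound keeps both truncated subtractions exact; beyond it the ratio is no longer 4.
2^[N∸2j]≡4*2^[N∸2[j+1]] : ∀ N j → 2 * suc j ≤ N →
  2 ^ (N ∸ 2 * j) ≡ 4 * 2 ^ (N ∸ 2 * suc j)
2^[N∸2j]≡4*2^[N∸2[j+1]] N j 2[j+1]≤N = begin
  2 ^ (N ∸ 2 * j)                         ≡⟨ cong (λ n → 2 ^ (n ∸ 2 * j)) (m+[n∸m]≡n 2[j+1]≤N) ⟨
  2 ^ (2 * suc j + e ∸ 2 * j)             ≡⟨ cong (λ n → 2 ^ (n ∸ 2 * j)) (shift j e) ⟩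
  2 ^ (2 * j + (2 + e) ∸ 2 * j)           ≡⟨ cong (2 ^_) (m+n∸m≡n (2 * j) (2 + e)) ⟩
  2 ^ (2 + e)                             ≡⟨ *-assoc 2 2 (2 ^ e) ⟨
  4 * 2 ^ e                               ∎
  where
  e = N ∸ 2 * suc j

  shift : ∀ j e → 2 * suc j + e ≡ 2 * j + (2 + e)
  shift = solve-∀

-- With j = r + d, the ratio of consecutive terms is the product of 2(2j+1)/(j+1) from the central
-- binomial, (j+1)/(d+1) from C(j,r) and 1/4 from the power of 2. The factor j+1 cancels.
summand-suc : ∀ N r d → 2 * suc (r + d) ≤ N →
  suc (2 * (r + d)) * summand N r (r + d) ≡ 2 * suc d * summand N r (suc (r + d))
summand-suc N r d bound = begin
  suc (2 * j) * (c * b * 2 ^ (N ∸ 2 * j))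
    ≡⟨ cong (λ z → suc (2 * j) * (c * b * z)) (2^[N∸2j]≡4*2^[N∸2[j+1]] N j bound) ⟩
  suc (2 * j) * (c * b * (4 * w))
    ≡⟨ regroup₁ (suc (2 * j)) c b w ⟩
  2 * (2 * (suc (2 * j) * c)) * b * w
    ≡⟨ cong (λ z → 2 * z * b * w) (centralBinomial-suc j) ⟨
  2 * (suc j * c′) * b * w
    ≡⟨ regroup₂ (suc j) c′ b w ⟩
  2 * c′ * (suc j * b) * w
    ≡⟨ cong (λ z → 2 * c′ * z * w) ([d+1]*[r+d+1]Cr≡[r+d+1]*[r+d]Cr r d) ⟨
  2 * c′ * (suc d * b′) * w
    ≡⟨ regroup₃ (suc d) c′ b′ w ⟩
  2 * suc d * (c′ * b′ * w) ∎
  where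
  j  = r + d
  c  = (2 * j) C j
  b  = j C r
  c′ = (2 * suc j) C suc j
  b′ = suc j C r
  w  = 2 ^ (N ∸ 2 * suc j)

  regroup₁ : ∀ n c b w → n * (c * b * (4 * w)) ≡ 2 * (2 * (n * c)) * b * w
  regroup₁ = solve-∀

  regroup₂ : ∀ n c b w → 2 * (n * c) * b * w ≡ 2 * c * (n * b) * w
  regroup₂ = solve-∀

  regroup₃ : ∀ n c b w → 2 * c * (n * b) * w ≡ 2 * n * (c * b * w)
  regroup₃ = solve-∀

-- Induction on the number of added terms, with `N` fixed while the upper limit grows. The term
-- ratio rewrites the old right-hand side as a multiple of the new term.
sumFromTo-summand : ∀ N r d → 2 * (r + d) ≤ N →
  suc (2 * r) * sumFromTo r (r + d) (summand N r) ≡ suc (2 * (r + d)) * summand N r (r + d)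
sumFromTo-summand N r zero _ = begin
  suc (2 * r) * sumFromTo r (r + 0) (summand N r)
    ≡⟨ cong (λ j → suc (2 * r) * sumFromTo r j (summand N r)) (+-identityʳ r) ⟩
  suc (2 * r) * sumFromTo r r (summand N r)
    ≡⟨ cong (suc (2 * r) *_) (sumFromTo-singleton r (summand N r)) ⟩
  suc (2 * r) * summand N r r
    ≡⟨ cong (λ j → suc (2 * j) * summand N r j) (+-identityʳ r) ⟨
  suc (2 * (r + 0)) * summand N r (r + 0) ∎
sumFromTo-summand N r (suc d) bound = begin
  suc (2 * r) * sumFromTo r (r + suc d) (summand N r)
    ≡⟨ cong (λ j → suc (2 * r) * sumFromTo r j (summand N r)) (+-suc r d) ⟩
  suc (2 * r) * sumFromTo r (suc j) (summand N r)
    ≡⟨ cong (suc (2 * r) *_) (sumFromTo-suc r d (summand N r)) ⟩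
  suc (2 * r) * (sumFromTo r j (summand N r) + t)
    ≡⟨ *-distribˡ-+ (suc (2 * r)) (sumFromTo r j (summand N r)) t ⟩
  suc (2 * r) * sumFromTo r j (summand N r) + suc (2 * r) * t
    ≡⟨ cong (_+ suc (2 * r) * t) (sumFromTo-summand N r d 2j≤N) ⟩
  suc (2 * j) * summand N r j + suc (2 * r) * t
    ≡⟨ cong (_+ suc (2 * r) * t) (summand-suc N r d 2[j+1]≤N) ⟩
  2 * suc d * t + suc (2 * r) * t
    -- The coefficients add up as 2(d+1) + (2r+1) = 2(r+d+1) + 1, the weight of the closed form at
    -- the next upper limit.
    ≡⟨ combine r d t ⟩
  suc (2 * suc j) * t
    ≡⟨ cong (λ j → suc (2 * j) * summand N r j) (+-suc r d) ⟨
  suc (2 * (r + suc d)) * summand N r (r + suc d) ∎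
  where
  j = r + d
  t = summand N r (suc j)

  2[j+1]≤N : 2 * suc j ≤ N
  2[j+1]≤N = subst (λ n → 2 * n ≤ N) (+-suc r d) bound

  2j≤N : 2 * j ≤ N
  2j≤N = ≤-trans (*-monoʳ-≤ 2 (n≤1+n j)) 2[j+1]≤N

  combine : ∀ r d t → 2 * suc d * t + suc (2 * r) * t ≡ suc (2 * suc (r + d)) * t
  combine = solve-∀

-- Divisibility and congruences modulo a prime.

prime∣C : ∀ {n k} → Prime (suc n) → k < n → suc n ∣ℕ suc n C suc k
prime∣C {n} {k} pr k<n
  -- By absorption the prime divides this product, and the first factor is positive and smaller than
  -- the prime.
  with euclidsLemma (suc k) (suc n C suc k) pr
         (subst (suc n ∣ℕ_) (sym ([k+1]*[n+1]C[k+1]≡[n+1]*nCk n k)) (m∣m*n (n C k)))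
... | inj₁ p∣k+1 = contradiction (∣⇒≤ p∣k+1) (<⇒≱ (s<s k<n))
... | inj₂ p∣C   = p∣C

-- Neighbouring entries of row p-1 add up to an inner entry of row p, which p divides, so each step
-- in `k` flips the sign. The induction runs in signed divisibility, which is closed under
-- subtraction.
[p-1]Ck≡[-1]^k : ∀ {n} → Prime (suc n) → ∀ k → k ≤ n → (+ (n C k)) ≡ (-1ℤ ^ℤ k) [mod suc n ]
[p-1]Ck≡[-1]^k {n} pr k k≤n = ℤ∣.∣⇒∣ᵤ (go k k≤n)
  where
  -- Here `a` and `b` are the neighbouring entries and `s` is the current sign: the multiple `a + b`
  -- of p minus the induction hypothesis `a - s` yields the next case.
  pascal : ∀ a b s → (a ℤ.+ b) ℤ.- (a ℤ.- s) ≡ b ℤ.- -1ℤ ℤ.* s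
  pascal = ℤSolver.solve-∀

  go : ∀ k → k ≤ n → + suc n ℤ∣.∣ + (n C k) ℤ.- -1ℤ ^ℤ k
  go zero    _   = ℤ∣.divides 0ℤ refl
  go (suc k) k<n = subst (+ suc n ℤ∣.∣_)
    (trans (cong (λ z → + z ℤ.- (+ (n C k) ℤ.- -1ℤ ^ℤ k)) (sym (nCk+nC[k+1]≡[n+1]C[k+1] n k)))
           (pascal (+ (n C k)) (+ (n C suc k)) (-1ℤ ^ℤ k)))
    (ℤ∣.∣m∣n⇒∣m-n (ℤ∣.∣ᵤ⇒∣ {i = + (suc n C suc k)} (prime∣C pr k<n)) (go k (<⇒≤ k<n)))

odd⇒2*[n/2]≡n : ∀ n → 2 ∤ suc n → 2 * (n / 2) ≡ n
odd⇒2*[n/2]≡n n 2∤n+1 with n % 2 | m≡m%n+[m/n]*n n 2 | m%n<n n 2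
... | 0           | n≡2q   | _ = trans (*-comm 2 (n / 2)) (sym n≡2q)
-- If n = 2q + 1, then n + 1 = (q + 1) · 2, against oddness.
... | 1           | n≡2q+1 | _ = contradiction
  (subst (2 ∣ℕ_) (cong suc (sym n≡2q+1)) (divides (suc (n / 2)) refl)) 2∤n+1
... | suc (suc _) | _      | s≤s (s≤s ())

-- Writing the prime as 2h + 1 makes it literally the factor in front of the closed form at upper
-- limit `h`; the cofactor 2r + 1 of the sum is too small to absorb it.
prime∣sumFromTo-summand : ∀ h {r} → Prime (suc (2 * h)) → r < h →
  suc (2 * h) ∣ℕ sumFromTo r h (summand (2 * h) r)
prime∣sumFromTo-summand h {r} pr r<h
  with euclidsLemma (suc (2 * r)) (sumFromTo r h (summand (2 * h) r)) pr
         (subst (suc (2 * h) ∣ℕ_) (sym closedForm) (m∣m*n (summand (2 * h) r h)))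
  where
  closedForm : suc (2 * r) * sumFromTo r h (summand (2 * h) r) ≡ suc (2 * h) * summand (2 * h) r h
  closedForm = subst
    (λ j → suc (2 * r) * sumFromTo r j (summand (2 * h) r) ≡ suc (2 * j) * summand (2 * h) r j)
    (m+[n∸m]≡n (<⇒≤ r<h))
    (sumFromTo-summand (2 * h) r (h ∸ r) (≤-reflexive (cong (2 *_) (m+[n∸m]≡n (<⇒≤ r<h)))))
... | inj₁ p∣2r+1 = contradiction (∣⇒≤ p∣2r+1) (<⇒≱ (s<s (*-monoʳ-< 2 r<h)))
... | inj₂ p∣S    = p∣S

sumFromTo-summand-diagonal : ∀ h → sumFromTo h h (summand (2 * h) h) ≡ (2 * h) C h
sumFromTo-summand-diagonal h = begin
  sumFromTo h h (summand (2 * h) h)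
    ≡⟨ sumFromTo-singleton h (summand (2 * h) h) ⟩
  ((2 * h) C h) * (h C h) * 2 ^ (2 * h ∸ 2 * h)
    ≡⟨ cong₂ (λ x e → ((2 * h) C h) * x * 2 ^ e) (nCn≡1 h) (n∸n≡0 (2 * h)) ⟩
  ((2 * h) C h) * 1 * 1
    ≡⟨ trans (*-identityʳ _) (*-identityʳ _) ⟩
  (2 * h) C h ∎

theorem4p2 : (p : ℕ) → Prime p → 2 ∤ p →
    (r : ℕ) → r ≤ (p ∸ 1) / 2 →
    let S = ∑[ j from r to (p ∸ 1) / 2 ] (((2 * j) C j) * (j C r) * 2 ^ (p ∸ 1 ∸ 2 * j)) in
      (r < (p ∸ 1) / 2 → (+ S) ≡ 0ℤ [mod p ])
      × (r ≡ (p ∸ 1) / 2 → (+ S) ≡ (-1ℤ ^ℤ ((p ∸ 1) / 2)) [mod p ])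
theorem4p2 zero    _  2∤0 _ _ = contradiction (divides 0 refl) 2∤0
theorem4p2 (suc n) pr 2∤p r _ = below , diagonal
  where
  h = n / 2

  2h≡n : 2 * h ≡ n
  2h≡n = odd⇒2*[n/2]≡n n 2∤p

  below : r < h → (+ sumFromTo r h (summand n r)) ≡ 0ℤ [mod suc n ]
  -- The congruence unfolds to divisibility of the absolute value of S - 0, so the subtraction of
  -- zero is removed first.
  below r<h = subst (λ z → suc n ∣ℕ ℤ.∣ z ∣) (sym (ℤ.+-identityʳ (+ sumFromTo r h (summand n r))))
    (subst (λ N → suc N ∣ℕ sumFromTo r h (summand N r)) 2h≡n
      (prime∣sumFromTo-summand h (subst (λ N → Prime (suc N)) (sym 2h≡n) pr) r<h))

  diagonal : r ≡ h → (+ sumFromTo r h (summand n r)) ≡ (-1ℤ ^ℤ h) [mod suc n ]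
  diagonal refl = subst (λ S → (+ S) ≡ (-1ℤ ^ℤ h) [mod suc n ])
    (sym (subst (λ N → sumFromTo h h (summand N h) ≡ N C h) 2h≡n (sumFromTo-summand-diagonal h)))
    ([p-1]Ck≡[-1]^k pr h (subst (h ≤_) 2h≡n (m≤n*m h 2)))
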